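{- Let $d$, $\Delta$, and $s$ be integers satisfying $1\le d\le\Delta$ and $0\le s<d$. Let $G$ be a finite simple $d$-degenerate graph with maximum degree $\Delta(G)\le\Delta$ and $q_B(G)\ge d\Delta-s$. Then some vertex $v$ of $G$ has distinct neighbors $u_1,\ldots,u_d$ such that $d_G(u_1)=\Delta$ and $$\sum_{j=2}^{d}|N_G(u_1)\setminus N_G(u_j)|\le s,\qquad \sum_{j=2}^{d}|N_G(u_1)\oplus N_G(u_j)|\le2s.$$ Consequently, at least $d-s$ of $u_1,\ldots,u_d$ have degree $\Delta$ and the same open neighborhood. In particular, $G$ contains copies of $K_{d-s,\Delta}$ and $K_{d,\Delta-s}$.
   Context: A $B$-coloring of a graph $G$ is a proper edge-coloring (incident edges receive distinct colors) in which the edges of every $4$-cycle receive four distinct colors; $q_B(G)$ is the minimum number of colors in a $B$-coloring of $G$. A graph is $d$-degenerate if every nonempty subgraph has a vertex of degree at most $d$ (in that subgraph). "Contains a copy of $K_{a,b}$" means contains a subgraph, not necessarily induced, isomorphic to the complete bipartite graph $K_{a,b}$. $N_G(x)$ is the open neighborhood of $x$, $d_G(x)$ its degree, $\Delta(G)$ the maximum degree of $G$, and $A\oplus B=(A\setminus B)\cup(B\setminus A)$. -}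

module Defs where

open import Data.Bool.Base using (Bool; true; false)
import Data.Bool.Properties as Bool
open import Data.Empty using (⊥-elim)
open import Data.Fin.Base using (Fin; toℕ; fromℕ<; combine; splitAt; funToFin; finToFun; remQuot)
open import Data.Fin.Properties as Fin
  using (_≟_; _≤?_; all?; any?; toℕ-injective; toℕ<n; toℕ-fromℕ<; combine-injective;
         finToFun-funToFin; remQuot-combine)
open import Data.Fin.Subset using (Subset; _∈_; _∪_; _─_; ∣_∣; Nonempty)
open import Data.List.Base using ([]; _∷_; tabulate)
open import Data.List.Extrema.Nat using (max)
open import Data.List.Relation.Unary.All using ([]; _∷_)
open import Data.List.Relation.Unary.AllPairs using ([]; _∷_)
open import Data.List.Relation.Unary.Unique.Propositional using (Unique)
import Data.List.Relation.Unary.Unique.DecPropositional as UniqueDec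
open import Data.Nat.Base using (ℕ; zero; suc; _+_; _*_; _^_; _≤_; _<_; s≤s; _⊓_)
import Data.Nat.Properties as ℕ
open import Data.Product.Base using (∃; _×_; _,_; proj₁; proj₂; uncurry)
open import Data.Sum.Base using (_⊎_; inj₁; inj₂; [_,_]′)
import Data.Vec.Base as Vec
open import Function.Base using (_∘_; const)
open import Function.Definitions using (Injective)
open import Level using (0ℓ)
open import Relation.Binary.Core using (Rel)
open import Relation.Binary.Definitions using (Decidable; Symmetric; Irreflexive)
open import Relation.Binary.PropositionalEquality
  using (_≡_; _≢_; refl; sym; trans; cong; cong₂; subst; subst₂; ≢-sym)
open import Relation.Nullary using (¬_; Dec; yes; no; does; contradiction)
open import Relation.Nullary.Decidable using (map′; ¬?; _×-dec_; _→-dec_)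
import Relation.Unary as U

------------------------------------------------------------------------
-- Finite simple graphs

record Graph (n : ℕ) : Set₁ where
  field
    Adj    : Rel (Fin n) 0ℓ
    adj?   : Decidable Adj
    symm   : Symmetric Adj
    irrefl : Irreflexive _≡_ Adj

open Graph public

N : ∀ {n} → Graph n → Fin n → Subset n
N G x = Vec.tabulate (λ y → does (adj? G x y))

degree : ∀ {n} → Graph n → Fin n → ℕ
degree G x = ∣ N G x ∣

-- The graph without vertices has maximum degree 0.
maxDegree : ∀ {n} → Graph n → ℕ
maxDegree G = max 0 (tabulate (degree G))

infixl 5 _⊕_

_⊕_ : ∀ {n} → Subset n → Subset n → Subset n
p ⊕ q = (p ─ q) ∪ (q ─ p)

-- A subgraph is a vertex set together with a set of edges of G between
-- these vertices, not necessarily all of them.  The edges are stored as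
-- a graph on the vertices of G, in which the vertices outside the
-- subgraph are isolated.
record Subgraph {n} (G : Graph n) : Set₁ where
  field
    vertices : Subset n
    edges    : Graph n
    edges⊆   : ∀ {x y} → Adj edges x y → Adj G x y
    ends     : ∀ {x y} → Adj edges x y → x ∈ vertices

open Subgraph public

Degenerate : ∀ {n} → ℕ → Graph n → Set₁
Degenerate d G = (H : Subgraph G) → Nonempty (vertices H) →
  ∃ λ x → x ∈ vertices H × degree (edges H) x ≤ d

ContainsCopy : ∀ {m n} → Graph m → Graph n → Set
ContainsCopy {m} {n} H G = ∃ λ (f : Fin m → Fin n) →
  Injective _≡_ _≡_ f × (∀ {x y} → Adj H x y → Adj G (f x) (f y))

-- The parts of K a b are the first a and the last b vertices.
side : ∀ a {b} → Fin (a + b) → Bool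
side a x = [ const true , const false ]′ (splitAt a x)

K : ∀ a b → Graph (a + b)
K a b = record
  { Adj    = λ x y → side a x ≢ side a y
  ; adj?   = λ x y → ¬? (side a x Bool.≟ side a y)
  ; symm   = ≢-sym
  ; irrefl = λ { refl x≢x → x≢x refl }
  }

------------------------------------------------------------------------
-- B-colorings

record FourCycle {n} (G : Graph n) (w x y z : Fin n) : Set where
  constructor fourCycle
  field
    distinct : Unique (w ∷ x ∷ y ∷ z ∷ [])
    wx       : Adj G w x
    xy       : Adj G x y
    yz       : Adj G y z
    zw       : Adj G z w

-- The color of the edge xy is c x y = c y x; the values of c on
-- non-adjacent pairs carry no information.  The colors are 0, …, k - 1.
record IsBColoring {n} (G : Graph n) (k : ℕ) (c : Fin n → Fin n → ℕ) : Set where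
  constructor isBColoring
  field
    bounded   : ∀ x y → Adj G x y → c x y < k
    symmetric : ∀ x y → Adj G x y → c x y ≡ c y x
    proper    : ∀ x y z → Adj G x y → Adj G x z → y ≢ z → c x y ≢ c x z
    rainbow   : ∀ w x y z → FourCycle G w x y z →
                Unique (c w x ∷ c x y ∷ c y z ∷ c z w ∷ [])

BColorable : ∀ {n} → Graph n → ℕ → Set
BColorable G k = ∃ (IsBColoring G k)

IsLeast : (ℕ → Set) → ℕ → Set
IsLeast P m = P m × (∀ {k} → P k → m ≤ k)

-- The minimum defining q_B exists: k-colorability is decidable, and
-- giving all edges different colors is a B-coloring.

fourCycle? : ∀ {n} (G : Graph n) w x y z → Dec (FourCycle G w x y z)
fourCycle? G w x y z = map′
  (λ (u , a , b , c , d) → fourCycle u a b c d)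
  (λ (fourCycle u a b c d) → u , a , b , c , d)
  (UniqueDec.unique? _≟_ _ ×-dec adj? G w x ×-dec adj? G x y ×-dec
   adj? G y z ×-dec adj? G z w)

isBColoring? : ∀ {n} (G : Graph n) k c → Dec (IsBColoring G k c)
isBColoring? G k c = map′
  (λ (a , b , p , r) → isBColoring a b p r)
  (λ (isBColoring a b p r) → a , b , p , r)
  (     (all? λ x → all? λ y → adj? G x y →-dec (c x y ℕ.<? k))
  ×-dec (all? λ x → all? λ y → adj? G x y →-dec (c x y ℕ.≟ c y x))
  ×-dec (all? λ x → all? λ y → all? λ z →
           adj? G x y →-dec (adj? G x z →-dec
             (¬? (y ≟ z) →-dec ¬? (c x y ℕ.≟ c x z))))
  ×-dec (all? λ w → all? λ x → all? λ y → all? λ z →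
           fourCycle? G w x y z →-dec UniqueDec.unique? ℕ._≟_ _))

isBColoring-resp : ∀ {n} (G : Graph n) {k c c′} →
  (∀ x y → Adj G x y → c x y ≡ c′ x y) →
  IsBColoring G k c → IsBColoring G k c′
isBColoring-resp G {k} {c} {c′} eq (isBColoring a b p r) = isBColoring
  (λ x y e → subst (_< k) (eq x y e) (a x y e))
  (λ x y e → trans (sym (eq x y e)) (trans (b x y e) (eq y x (symm G e))))
  (λ x y z e f y≢z → subst₂ _≢_ (eq x y e) (eq x z f) (p x y z e f y≢z))
  (λ w x y z C → subst Unique (eqs C) (r w x y z C))
  where
  eqs : ∀ {w x y z} → FourCycle G w x y z →
        c w x ∷ c x y ∷ c y z ∷ c z w ∷ [] ≡
        c′ w x ∷ c′ x y ∷ c′ y z ∷ c′ z w ∷ []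
  eqs (fourCycle _ wx xy yz zw) =
    cong₂ _∷_ (eq _ _ wx) (cong₂ _∷_ (eq _ _ xy)
      (cong₂ _∷_ (eq _ _ yz) (cong₂ _∷_ (eq _ _ zw) refl)))

-- Up to values on non-edges, a B-coloring with k colors is one of the
-- finitely many functions with values in 0, …, k.
decode : ∀ {n k} → Fin (suc k ^ (n * n)) → Fin n → Fin n → ℕ
decode i x y = toℕ (finToFun i (combine x y))

bColorable? : ∀ {n} (G : Graph n) → U.Decidable (BColorable G)
bColorable? {n} G k = map′
  (λ (i , col) → decode i , col)
  (λ (c , col) → encode c , isBColoring-resp G (agree c col) col)
  (any? λ i → isBColoring? G k (decode {n} {k} i))
  where
  clamp : (Fin n → Fin n → ℕ) → Fin (n * n) → Fin (suc k)
  clamp c e = fromℕ< {uncurry c (remQuot n e) ⊓ k} (s≤s (ℕ.m⊓n≤n _ k))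

  encode : (Fin n → Fin n → ℕ) → Fin (suc k ^ (n * n))
  encode c = funToFin (clamp c)

  agree : ∀ c → IsBColoring G k c → ∀ x y → Adj G x y → c x y ≡ decode (encode c) x y
  agree c col x y e = sym (trans
    (cong toℕ (finToFun-funToFin (clamp c) (combine x y)))
    (trans (toℕ-fromℕ< _)
    (trans (cong (λ p → uncurry c p ⊓ k) (remQuot-combine x y))
           (ℕ.m≤n⇒m⊓n≡m (ℕ.<⇒≤ (IsBColoring.bounded col x y e))))))

sort : ∀ {n} → Fin n → Fin n → Fin n × Fin n
sort x y with x ≤? y
... | yes _ = x , y
... | no  _ = y , x

sort-comm : ∀ {n} (x y : Fin n) → sort x y ≡ sort y x
sort-comm x y with x ≤? y | y ≤? x
... | yes x≤y | yes y≤x = cong₂ _,_ (Fin.≤-antisym x≤y y≤x) (Fin.≤-antisym y≤x x≤y)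
... | yes _   | no  _   = refl
... | no  _   | yes _   = refl
... | no  x≰y | no  y≰x = contradiction (ℕ.<⇒≤ (ℕ.≰⇒> x≰y)) y≰x

sort-injective : ∀ {n} {x y x′ y′ : Fin n} → sort x y ≡ sort x′ y′ →
  (x ≡ x′ × y ≡ y′) ⊎ (x ≡ y′ × y ≡ x′)
sort-injective {x = x} {y} {x′} {y′} eq with x ≤? y | x′ ≤? y′
... | yes _ | yes _ = inj₁ (cong proj₁ eq , cong proj₂ eq)
... | yes _ | no  _ = inj₂ (cong proj₁ eq , cong proj₂ eq)
... | no  _ | yes _ = inj₂ (cong proj₂ eq , cong proj₁ eq)
... | no  _ | no  _ = inj₁ (cong proj₂ eq , cong proj₁ eq)

allDifferent : ∀ {n} → Fin n → Fin n → ℕ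
allDifferent x y = toℕ (uncurry combine (sort x y))

allDifferent-injective : ∀ {n} {x y x′ y′ : Fin n} →
  allDifferent x y ≡ allDifferent x′ y′ →
  (x ≡ x′ × y ≡ y′) ⊎ (x ≡ y′ × y ≡ x′)
allDifferent-injective eq =
  let (p , q) = combine-injective _ _ _ _ (toℕ-injective eq)
  in sort-injective (cong₂ _,_ p q)

allDifferent-isBColoring : ∀ {n} (G : Graph n) → IsBColoring G (n * n) allDifferent
allDifferent-isBColoring G = isBColoring
  (λ x y _ → toℕ<n (uncurry combine (sort x y)))
  (λ x y _ → cong (toℕ ∘ uncurry combine) (sort-comm x y))
  (λ x y z _ _ y≢z eq → [ (λ (_ , p) → y≢z p) , (λ (p , q) → y≢z (trans q p)) ]′
                          (allDifferent-injective {x = x} {y} {x} {z} eq))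
  λ { w x y z (fourCycle ((w≢x ∷ w≢y ∷ w≢z ∷ []) ∷ (x≢y ∷ x≢z ∷ []) ∷ (y≢z ∷ []) ∷ [] ∷ []) _ _ _ _) →
      (differ (w≢x ∘ proj₁) (w≢y ∘ proj₁)
      ∷ differ (w≢y ∘ proj₁) (w≢z ∘ proj₁)
      ∷ differ (w≢z ∘ proj₁) (x≢z ∘ proj₂) ∷ [])
    ∷ (differ (x≢y ∘ proj₁) (x≢z ∘ proj₁)
      ∷ differ (x≢z ∘ proj₁) (y≢z ∘ proj₂) ∷ [])
    ∷ (differ (y≢z ∘ proj₁) (≢-sym w≢y ∘ proj₁) ∷ [])
    ∷ [] ∷ [] }
  where
  differ : ∀ {x y x′ y′} → ¬ (x ≡ x′ × y ≡ y′) → ¬ (x ≡ y′ × y ≡ x′) →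
           allDifferent x y ≢ allDifferent x′ y′
  differ f g = [ f , g ]′ ∘ allDifferent-injective

least : ∀ {P : ℕ → Set} → U.Decidable P → ∀ {k} → P k → ∃ (IsLeast P)
least {P} P? {k} pk with search (suc k)
  where
  search : ∀ m → ∃ (IsLeast P) ⊎ (∀ {j} → j < m → ¬ P j)
  search zero = inj₂ λ ()
  search (suc m) with search m
  ... | inj₁ found = inj₁ found
  ... | inj₂ none with P? m
  ...   | yes pm = inj₁ (m , pm , λ pj → ℕ.≮⇒≥ (λ j<m → none j<m pj))
  ...   | no ¬pm = inj₂ λ {j} j<1+m pj →
            [ (λ j<m → none j<m pj) , (λ j≡m → ¬pm (subst P j≡m pj)) ]′
            (ℕ.m≤n⇒m<n∨m≡n (ℕ.≤-pred j<1+m))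
... | inj₁ found = found
... | inj₂ none  = ⊥-elim (none ℕ.≤-refl pk)

bChromaticIndex : ∀ {n} (G : Graph n) → ∃ (IsLeast (BColorable G))
bChromaticIndex G = least (bColorable? G) (allDifferent , allDifferent-isBColoring G)

qB : ∀ {n} → Graph n → ℕ
qB G = proj₁ (bChromaticIndex G)

{-# OPTIONS --safe #-}
module Submission where

-- Try to color G with dΔ - s - 1 colors, adding the vertices in degeneracy order.  When v
-- is added, an old edge u′w blocks the edge vu only if w is a common neighbor of u and u′ (with u′ = u
-- for the edges at u), so, the other edges at v included, vu has to avoid fewer than
-- Σ_{u′} |N(u) ∩ N(u′)| colors, the sum being over the at most d neighbors u′ of v.  As there is
-- no such coloring, this sum is at least dΔ - s for some u = u₁.  Its terms are at most |N(u₁)| ≤ Δ and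
-- s < d ≤ Δ, so v has exactly d such neighbors, |N(u₁)| = Δ, and the terms fall short
-- of Δ by Σ_j |N(u₁) ∖ N(u_j)| ≤ s in total.

open import Defs
open import Data.Bool.Base using (true; false)
open import Data.Fin.Base using (Fin; zero; suc; toℕ; fromℕ<; inject≤; splitAt; join)
import Data.Fin.Properties as Fin
open import Data.Fin.Properties using (_≟_)
open import Data.Fin.Subset
  using (Subset; _∈_; _∉_; _⊆_; _⊂_; _∩_; _∪_; _─_; _-_; ∣_∣; ⊤)
open import Data.Fin.Subset.Induction using (Acc; acc; ⊂-wellFounded)
import Data.Fin.Subset.Properties as Subset
open import Data.List.Base
  using (List; []; _∷_; _++_; length; lookup; map; concatMap; foldr; sum; drop; tabulate)
import Data.List.Properties as List
open import Data.List.Extrema.Nat using (xs≤max)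
import Data.List.Membership.Propositional as List
open import Data.List.Membership.Propositional.Properties
  using (∈-map⁺; ∈-map⁻; ∈-++⁺ˡ; ∈-++⁺ʳ; ∈-concatMap⁺; ∈-lookup; ∈-∃++)
open import Data.List.Membership.DecPropositional using (_∈?_)
open import Data.List.Relation.Binary.Permutation.Propositional
  using (_↭_; ↭-sym; ↭⇒↭ₛ)
open import Data.List.Relation.Binary.Permutation.Propositional.Properties
  using (shift; ∈-resp-↭; ↭-length) renaming (map⁺ to ↭-map⁺)
import Data.List.Relation.Binary.Permutation.Setoid.Properties as Permutationₛ
open import Data.List.Relation.Unary.All as All using ([]; _∷_)
open import Data.List.Relation.Unary.All.Properties using (¬All⇒Any¬; tabulate⁻)
open import Data.List.Relation.Unary.AllPairs using ([]; _∷_)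
open import Data.List.Relation.Unary.Any using (here; there; index)
open import Data.List.Relation.Unary.Any.Properties using (lookup-index)
open import Data.List.Relation.Unary.Unique.Propositional using (Unique)
open import Data.List.Relation.Unary.Unique.Propositional.Properties
  using () renaming (map⁺ to Unique-map⁺)
open import Data.Nat.Base
  using (ℕ; zero; suc; _+_; _*_; _∸_; _≤_; _<_; z≤n; s≤s)
open import Data.Nat.ListAction.Properties using (sum-↭)
import Data.Nat.Properties as ℕ
open import Data.Nat.Tactic.RingSolver using (solve-∀)
open import Data.Product.Base using (∃; _×_; _,_; proj₁; proj₂)
open import Data.Sum.Base using (_⊎_; inj₁; inj₂; [_,_]′)
import Data.Vec.Base as Vec
open import Data.Vec.Base using ([]; _∷_)
import Data.Vec.Properties as Vec
open import Function.Base using (_∘_; case_of_)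
open import Function.Definitions using (Injective)
open import Relation.Binary.Definitions using (DecidableEquality)
open import Relation.Binary.PropositionalEquality
  using (_≡_; _≢_; refl; sym; trans; cong; cong₂; subst; setoid; ≢-sym; module ≡-Reasoning)
open import Relation.Nullary using (yes; no; does; contradiction)
open import Relation.Nullary.Decidable using (¬?; _×-dec_; dec-true; decidable-stable)
import Relation.Unary as U

-- Subsets given by decidable predicates, and sizes of differences.

module _ {n} {P : Fin n → Set} (P? : U.Decidable P) where

  ∈-comprehension⁺ : ∀ {i} → P i → i ∈ Vec.tabulate (does ∘ P?)
  ∈-comprehension⁺ {i} p =
    Vec.lookup⇒[]= i _ (trans (Vec.lookup∘tabulate _ i) (dec-true (P? i) p))

  ∈-comprehension⁻ : ∀ {i} → i ∈ Vec.tabulate (does ∘ P?) → P i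
  ∈-comprehension⁻ {i} i∈ with P? i | trans (sym (Vec.lookup∘tabulate (does ∘ P?) i)) (Vec.[]=⇒lookup i∈)
  ... | yes p | _ = p
  ... | no  _ | ()

∣p∣≡∣p∩q∣+∣p─q∣ : ∀ {n} (p q : Subset n) → ∣ p ∣ ≡ ∣ p ∩ q ∣ + ∣ p ─ q ∣
∣p∣≡∣p∩q∣+∣p─q∣ []          []          = refl
∣p∣≡∣p∩q∣+∣p─q∣ (false ∷ p) (false ∷ q) = ∣p∣≡∣p∩q∣+∣p─q∣ p q
∣p∣≡∣p∩q∣+∣p─q∣ (false ∷ p) (true  ∷ q) = ∣p∣≡∣p∩q∣+∣p─q∣ p q
∣p∣≡∣p∩q∣+∣p─q∣ (true  ∷ p) (false ∷ q) =
  trans (cong suc (∣p∣≡∣p∩q∣+∣p─q∣ p q)) (sym (ℕ.+-suc _ _))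
∣p∣≡∣p∩q∣+∣p─q∣ (true  ∷ p) (true  ∷ q) = cong suc (∣p∣≡∣p∩q∣+∣p─q∣ p q)

∣p∪q∣≤∣p∣+∣q∣ : ∀ {n} (p q : Subset n) → ∣ p ∪ q ∣ ≤ ∣ p ∣ + ∣ q ∣
∣p∪q∣≤∣p∣+∣q∣ []          []          = z≤n
∣p∪q∣≤∣p∣+∣q∣ (false ∷ p) (false ∷ q) = ∣p∪q∣≤∣p∣+∣q∣ p q
∣p∪q∣≤∣p∣+∣q∣ (false ∷ p) (true  ∷ q) =
  ℕ.≤-trans (s≤s (∣p∪q∣≤∣p∣+∣q∣ p q)) (ℕ.≤-reflexive (sym (ℕ.+-suc _ _)))
∣p∪q∣≤∣p∣+∣q∣ (true  ∷ p) (false ∷ q) = s≤s (∣p∪q∣≤∣p∣+∣q∣ p q)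
∣p∪q∣≤∣p∣+∣q∣ (true  ∷ p) (true  ∷ q) =
  s≤s (ℕ.≤-trans (∣p∪q∣≤∣p∣+∣q∣ p q) (ℕ.+-monoʳ-≤ ∣ p ∣ (ℕ.n≤1+n _)))

-- Both sets lose the same part `p ∩ q`, so the comparison of sizes survives. This lets bounds on
-- one-sided differences control symmetric differences, since `u₁` will have the largest degree.
∣q∣≤∣p∣⇒∣q─p∣≤∣p─q∣ : ∀ {n} (p q : Subset n) → ∣ q ∣ ≤ ∣ p ∣ → ∣ q ─ p ∣ ≤ ∣ p ─ q ∣
∣q∣≤∣p∣⇒∣q─p∣≤∣p─q∣ p q q≤p = ℕ.+-cancelˡ-≤ ∣ p ∩ q ∣ _ _ (begin
  ∣ p ∩ q ∣ + ∣ q ─ p ∣  ≡⟨ cong (λ r → ∣ r ∣ + ∣ q ─ p ∣) (Subset.∩-comm p q) ⟩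
  ∣ q ∩ p ∣ + ∣ q ─ p ∣  ≡⟨ ∣p∣≡∣p∩q∣+∣p─q∣ q p ⟨
  ∣ q ∣                  ≤⟨ q≤p ⟩
  ∣ p ∣                  ≡⟨ ∣p∣≡∣p∩q∣+∣p─q∣ p q ⟩
  ∣ p ∩ q ∣ + ∣ p ─ q ∣  ∎)
  where open ℕ.≤-Reasoning

∣p⊕q∣≤2∣p─q∣ : ∀ {n} (p q : Subset n) → ∣ q ∣ ≤ ∣ p ∣ → ∣ p ⊕ q ∣ ≤ 2 * ∣ p ─ q ∣
∣p⊕q∣≤2∣p─q∣ p q q≤p = ℕ.≤-trans (∣p∪q∣≤∣p∣+∣q∣ (p ─ q) (q ─ p))
  (ℕ.+-monoʳ-≤ ∣ p ─ q ∣
    (ℕ.≤-trans (∣q∣≤∣p∣⇒∣q─p∣≤∣p─q∣ p q q≤p) (ℕ.≤-reflexive (sym (ℕ.+-identityʳ _)))))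

x∈p─q⇒x∉q : ∀ {n} {x : Fin n} (p q : Subset n) → x ∈ p ─ q → x ∉ q
x∈p─q⇒x∉q (_ ∷ p) (true ∷ q) ()             Vec.here
x∈p─q⇒x∉q (_ ∷ p) (_    ∷ q) (Vec.there x∈) (Vec.there x∈q) = x∈p─q⇒x∉q p q x∈ x∈q

∣p─q∣≡0⇒p⊆q : ∀ {n} (p q : Subset n) → ∣ p ─ q ∣ ≡ 0 → p ⊆ q
∣p─q∣≡0⇒p⊆q p q eq {x} x∈p = decidable-stable (x Subset.∈? q) λ x∉q →
  ℕ.n≮0 (ℕ.<-≤-trans (Subset.x∈p⇒∣p-x∣<∣p∣ (Subset.x∈p∧x∉q⇒x∈p─q x∈p x∉q)) (ℕ.≤-reflexive eq))

-- The size hypothesis supplies the second inclusion: `q ─ p` is no larger than the empty set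
-- `p ─ q`.
∣p─q∣≡0⇒p≡q : ∀ {n} (p q : Subset n) → ∣ q ∣ ≤ ∣ p ∣ → ∣ p ─ q ∣ ≡ 0 → p ≡ q
∣p─q∣≡0⇒p≡q p q q≤p eq = Subset.⊆-antisym (∣p─q∣≡0⇒p⊆q p q eq)
  (∣p─q∣≡0⇒p⊆q q p (ℕ.n≤0⇒n≡0 (ℕ.≤-trans (∣q∣≤∣p∣⇒∣q─p∣≤∣p─q∣ p q q≤p) (ℕ.≤-reflexive eq))))

∣p─p∣≡0 : ∀ {n} (p : Subset n) → ∣ p ─ p ∣ ≡ 0
∣p─p∣≡0 p = ℕ.+-cancelˡ-≡ ∣ p ∣ _ _ (begin
  ∣ p ∣ + ∣ p ─ p ∣      ≡⟨ cong (λ q → ∣ q ∣ + ∣ p ─ p ∣) (Subset.∩-idem p) ⟨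
  ∣ p ∩ p ∣ + ∣ p ─ p ∣  ≡⟨ ∣p∣≡∣p∩q∣+∣p─q∣ p p ⟨
  ∣ p ∣                  ≡⟨ ℕ.+-identityʳ _ ⟨
  ∣ p ∣ + 0              ∎)
  where open ≡-Reasoning

-- Differences and intersections of one set with a list of sets.

module _ {a n} {A : Set a} (p : Subset n) (q : A → Subset n) where

  -- Each `q x` splits `p` into two parts. With neighborhoods for sets, a lower bound on codegrees
  -- becomes an upper bound on differences.
  sum-─+sum-∩ : ∀ xs →
    sum (map (λ x → ∣ p ─ q x ∣) xs) + sum (map (λ x → ∣ p ∩ q x ∣) xs) ≡ length xs * ∣ p ∣
  sum-─+sum-∩ []       = refl
  sum-─+sum-∩ (x ∷ xs) = begin
    (∣ p ─ q x ∣ + D) + (∣ p ∩ q x ∣ + I)  ≡⟨ interchange (∣ p ─ q x ∣) D (∣ p ∩ q x ∣) I ⟩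
    (∣ p ∩ q x ∣ + ∣ p ─ q x ∣) + (D + I)  ≡⟨ cong₂ _+_ (∣p∣≡∣p∩q∣+∣p─q∣ p (q x)) (sym (sum-─+sum-∩ xs)) ⟨
    ∣ p ∣ + length xs * ∣ p ∣              ∎
    where
    open ≡-Reasoning
    D = sum (map (λ x → ∣ p ─ q x ∣) xs)
    I = sum (map (λ x → ∣ p ∩ q x ∣) xs)
    interchange : ∀ a b c d → (a + b) + (c + d) ≡ (c + a) + (b + d)
    interchange = solve-∀

  -- Applied to neighborhoods, this is the common neighborhood of `u₁` and the other chosen
  -- vertices.
  intersect : List A → Subset n
  intersect = foldr (λ x r → r ∩ q x) p

  intersect⊆p : ∀ xs → intersect xs ⊆ p
  intersect⊆p []       = λ y∈p → y∈p
  intersect⊆p (x ∷ xs) = intersect⊆p xs ∘ Subset.p∩q⊆p _ (q x)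

  intersect⊆q : ∀ {x xs} → x List.∈ xs → intersect xs ⊆ q x
  intersect⊆q {xs = y ∷ xs} (here refl) = Subset.p∩q⊆q (intersect xs) (q y)
  intersect⊆q {xs = y ∷ xs} (there x∈)  = intersect⊆q x∈ ∘ Subset.p∩q⊆p _ (q y)

  -- Union bound: intersecting with `q x` removes only elements of `p ─ q x`.
  ∣p∣≤∣intersect∣+sum-─ : ∀ xs → ∣ p ∣ ≤ ∣ intersect xs ∣ + sum (map (λ x → ∣ p ─ q x ∣) xs)
  ∣p∣≤∣intersect∣+sum-─ []       = ℕ.m≤m+n _ 0
  ∣p∣≤∣intersect∣+sum-─ (x ∷ xs) = begin
    ∣ p ∣                                      ≤⟨ ∣p∣≤∣intersect∣+sum-─ xs ⟩
    ∣ r ∣ + D                                  ≡⟨ cong (_+ D) (∣p∣≡∣p∩q∣+∣p─q∣ r (q x)) ⟩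
    ∣ r ∩ q x ∣ + ∣ r ─ q x ∣ + D              ≡⟨ ℕ.+-assoc ∣ r ∩ q x ∣ _ _ ⟩
    ∣ r ∩ q x ∣ + (∣ r ─ q x ∣ + D)            ≤⟨ ℕ.+-monoʳ-≤ ∣ r ∩ q x ∣ (ℕ.+-monoˡ-≤ D
                                                    (Subset.p⊆q⇒∣p∣≤∣q∣ r─q⊆p─q)) ⟩
    ∣ r ∩ q x ∣ + (∣ p ─ q x ∣ + D)            ∎
    where
    open ℕ.≤-Reasoning
    r = intersect xs
    D = sum (map (λ x → ∣ p ─ q x ∣) xs)
    r─q⊆p─q : r ─ q x ⊆ p ─ q x
    r─q⊆p─q {y} y∈ = Subset.x∈p∧x∉q⇒x∈p─q (intersect⊆p xs (Subset.p─q⊆p r (q x) y∈))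
      (x∈p─q⇒x∉q r (q x) y∈)

-- Vanishing terms of a sum, lists of elements, and injections into a subset.

zeros : ∀ {d} → (Fin d → ℕ) → Subset d
zeros f = Vec.tabulate (λ i → does (f i ℕ.≟ 0))

-- An index outside `zeros f` contributes at least one to the sum.
d≤∣zeros∣+sum : ∀ {d} (f : Fin d → ℕ) → d ≤ ∣ zeros f ∣ + sum (tabulate f)
d≤∣zeros∣+sum {zero}  f = z≤n
d≤∣zeros∣+sum {suc d} f with f zero | d≤∣zeros∣+sum (f ∘ suc)
... | zero  | ih = s≤s ih
... | suc m | ih = ℕ.≤-trans (s≤s ih)
  (ℕ.≤-trans (ℕ.≤-reflexive (sym (ℕ.+-suc _ _))) (ℕ.+-monoʳ-≤ ∣ zeros (f ∘ suc) ∣ (s≤s (ℕ.m≤n+m _ m))))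

elements : ∀ {n} → Subset n → List (Fin n)
elements []          = []
elements (true  ∷ p) = zero ∷ map suc (elements p)
elements (false ∷ p) = map suc (elements p)

length-elements : ∀ {n} (p : Subset n) → length (elements p) ≡ ∣ p ∣
length-elements []          = refl
length-elements (true  ∷ p) = cong suc (trans (List.length-map {B = Fin _} suc (elements p)) (length-elements p))
length-elements (false ∷ p) = trans (List.length-map {B = Fin _} suc (elements p)) (length-elements p)

∈-elements⁺ : ∀ {n} {p : Subset n} {x} → x ∈ p → x List.∈ elements p
∈-elements⁺ {p = true  ∷ p} Vec.here       = here refl
∈-elements⁺ {p = true  ∷ p} (Vec.there x∈) = there (∈-map⁺ suc (∈-elements⁺ x∈))
∈-elements⁺ {p = false ∷ p} (Vec.there x∈) = ∈-map⁺ suc (∈-elements⁺ x∈)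

∈-elements⁻ : ∀ {n} (p : Subset n) {x} → x List.∈ elements p → x ∈ p
∈-elements⁻ (true  ∷ p) (here refl) = Vec.here
∈-elements⁻ (true  ∷ p) (there x∈) with _ , y∈ , refl ← ∈-map⁻ suc x∈ = Vec.there (∈-elements⁻ p y∈)
∈-elements⁻ (false ∷ p) x∈ with _ , y∈ , refl ← ∈-map⁻ suc x∈ = Vec.there (∈-elements⁻ p y∈)

elements-unique : ∀ {n} (p : Subset n) → Unique (elements p)
elements-unique []          = []
elements-unique (true  ∷ p) =
  All.tabulate (λ x∈ → case ∈-map⁻ suc x∈ of λ { (_ , _ , refl) () })
  ∷ Unique-map⁺ Fin.suc-injective (elements-unique p)
elements-unique (false ∷ p) = Unique-map⁺ Fin.suc-injective (elements-unique p)

lookup-injective : ∀ {a} {A : Set a} {xs : List A} → Unique xs → Injective _≡_ _≡_ (lookup xs)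
lookup-injective (x∉ ∷ xs!) {zero}  {zero}  eq = refl
lookup-injective (x∉ ∷ xs!) {zero}  {suc j} eq = contradiction eq (All.lookup x∉ (∈-lookup j))
lookup-injective (x∉ ∷ xs!) {suc i} {zero}  eq = contradiction (sym eq) (All.lookup x∉ (∈-lookup i))
lookup-injective (x∉ ∷ xs!) {suc i} {suc j} eq = cong suc (lookup-injective xs! eq)

choose : ∀ {a n} (p : Subset n) → a ≤ ∣ p ∣ →
  ∃ λ (f : Fin a → Fin n) → Injective _≡_ _≡_ f × (∀ i → f i ∈ p)
choose p a≤ = lookup (elements p) ∘ inj
  , Fin.inject≤-injective a≤′ a≤′ _ _ ∘ lookup-injective (elements-unique p)
  , λ i → ∈-elements⁻ p (∈-lookup (inj i))
  where
  a≤′ = ℕ.≤-trans a≤ (ℕ.≤-reflexive (sym (length-elements p)))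
  inj = λ i → inject≤ i a≤′

-- Greedy choice of distinct colors.

fresh : ∀ k (xs : List ℕ) → length xs < k → ∃ λ c → c < k × c List.∉ xs
fresh k xs xs<k with Fin.any? {n = k} (λ i → ¬? (_∈?_ ℕ._≟_ (toℕ i) xs))
... | yes (i , i∉) = toℕ i , Fin.toℕ<n i , i∉
-- If all `k` colors occurred in `xs`, two of them would first occur at the same position, as there
-- are fewer than `k` positions; but a position determines its color.
... | no  none =
  let i , j , i<j , eq = Fin.pigeonhole xs<k (index ∘ mem)
  in contradiction (trans (lookup-index (mem i)) (trans (cong (lookup xs) eq) (sym (lookup-index (mem j)))))
       (ℕ.<⇒≢ i<j)
  where
  mem : (i : Fin k) → toℕ i List.∈ xs
  mem i = decidable-stable (_∈?_ ℕ._≟_ (toℕ i) xs) (λ i∉ → none (i , i∉))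

module _ {a} {A : Set a} (_≟ᴬ_ : DecidableEquality A) (F : A → List ℕ) (k : ℕ) where

  -- The list is colored from its end. The head has to avoid its own list `F x` and the colors given
  -- to the tail.
  greedyChoice : ∀ {xs} → Unique xs → (∀ {x} → x List.∈ xs → length (F x) + length xs ≤ k) →
    ∃ λ (g : A → ℕ) → (∀ {x} → x List.∈ xs → g x < k × g x List.∉ F x)
      × (∀ {x y} → x List.∈ xs → y List.∈ xs → g x ≡ g y → x ≡ y)
  greedyChoice {[]}     _          _    = (λ _ → 0) , (λ ()) , (λ ())
  greedyChoice {x ∷ xs} (x∉ ∷ xs!) room = g , good , inj
    where
    ih = greedyChoice xs! λ y∈ →
      ℕ.≤-trans (ℕ.+-monoʳ-≤ _ (ℕ.n≤1+n _)) (room (there y∈))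
    g′ = proj₁ ih
    taken = F x ++ map g′ xs
    -- The length in `room` counts `x` itself, whereas `taken` has one color for each element of
    -- `xs` only; this makes the inequality strict.
    new = fresh k taken (ℕ.≤-trans
      (ℕ.≤-reflexive (trans
        (cong suc (trans (List.length-++ (F x)) (cong (length (F x) +_) (List.length-map g′ xs))))
        (sym (ℕ.+-suc (length (F x)) (length xs)))))
      (room (here refl)))
    c = proj₁ new
    g : A → ℕ
    g y with y ≟ᴬ x
    ... | yes _ = c
    ... | no  _ = g′ y
    g-x : g x ≡ c
    g-x with x ≟ᴬ x
    ... | yes _  = refl
    ... | no x≢x = contradiction refl x≢x
    g-xs : ∀ {y} → y List.∈ xs → g y ≡ g′ y
    g-xs {y} y∈ with y ≟ᴬ x
    ... | yes refl = contradiction refl (All.lookup x∉ y∈)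
    ... | no  _    = refl
    c≢ : ∀ {y} → y List.∈ xs → c ≢ g y
    c≢ y∈ eq = proj₂ (proj₂ new) (∈-++⁺ʳ (F x)
      (subst (List._∈ map g′ xs) (sym (trans eq (g-xs y∈))) (∈-map⁺ g′ y∈)))
    good : ∀ {y} → y List.∈ x ∷ xs → g y < k × g y List.∉ F y
    good (here refl) rewrite g-x = proj₁ (proj₂ new) , proj₂ (proj₂ new) ∘ ∈-++⁺ˡ
    good (there y∈) rewrite g-xs y∈ = proj₁ (proj₂ ih) y∈
    inj : ∀ {y z} → y List.∈ x ∷ xs → z List.∈ x ∷ xs → g y ≡ g z → y ≡ z
    inj (here refl) (here refl) _  = refl
    inj (here refl) (there z∈)  eq = contradiction (trans (sym g-x) eq) (c≢ z∈)
    inj (there y∈)  (here refl) eq = contradiction (trans (sym g-x) (sym eq)) (c≢ y∈)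
    inj (there y∈)  (there z∈)  eq = proj₂ (proj₂ ih) y∈ z∈
      (trans (sym (g-xs y∈)) (trans eq (g-xs z∈)))

-- Induced subgraphs and recoloring the edges at a vertex.

induced : ∀ {n} → Graph n → Subset n → Graph n
induced G S = record
  { Adj    = λ x y → Adj G x y × x ∈ S × y ∈ S
  ; adj?   = λ x y → adj? G x y ×-dec (x Subset.∈? S) ×-dec (y Subset.∈? S)
  ; symm   = λ (xy , x∈ , y∈) → symm G xy , y∈ , x∈
  ; irrefl = λ eq (xy , _) → irrefl G eq xy
  }

inducedSubgraph : ∀ {n} (G : Graph n) → Subset n → Subgraph G
inducedSubgraph G S = record
  { vertices = S ; edges = induced G S ; edges⊆ = proj₁ ; ends = proj₁ ∘ proj₂ }

isBColoring-mono : ∀ {n k c} {G H : Graph n} → (∀ {x y} → Adj G x y → Adj H x y) →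
  IsBColoring H k c → IsBColoring G k c
isBColoring-mono G⊆H (isBColoring b s p r) = isBColoring
  (λ x y xy → b x y (G⊆H xy))
  (λ x y xy → s x y (G⊆H xy))
  (λ x y z xy xz → p x y z (G⊆H xy) (G⊆H xz))
  (λ w x y z (fourCycle u wx xy yz zw) → r w x y z (fourCycle u (G⊆H wx) (G⊆H xy) (G⊆H yz) (G⊆H zw)))

-- Consecutive edges of a 4-cycle are incident, so rainbowness only concerns opposite edges.
isBColoring-opposite : ∀ {n k c} (G : Graph n) →
  (∀ x y → Adj G x y → c x y < k) →
  (∀ x y → Adj G x y → c x y ≡ c y x) →
  (∀ x y z → Adj G x y → Adj G x z → y ≢ z → c x y ≢ c x z) →
  (∀ w x y z → FourCycle G w x y z → c w x ≢ c y z) →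
  IsBColoring G k c
isBColoring-opposite {c = c} G b s p o = isBColoring b s p
  λ { w x y z C@(fourCycle ((w≢x ∷ w≢y ∷ w≢z ∷ []) ∷ (x≢y ∷ x≢z ∷ []) ∷ (y≢z ∷ []) ∷ [] ∷ []) wx xy yz zw) →
      (incident wx xy w≢y
      ∷ o w x y z C
      ∷ ≢-sym (incident zw wx (≢-sym x≢z)) ∷ [])
    ∷ (incident xy yz x≢z
      ∷ o x y z w (fourCycle ((x≢y ∷ x≢z ∷ ≢-sym w≢x ∷ []) ∷ (y≢z ∷ ≢-sym w≢y ∷ []) ∷ (≢-sym w≢z ∷ []) ∷ [] ∷ [])
          xy yz zw wx) ∷ [])
    ∷ (incident yz zw (≢-sym w≢y) ∷ [])
    ∷ [] ∷ [] }
  where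
  incident : ∀ {x y z} → Adj G x y → Adj G y z → x ≢ z → c x y ≢ c y z
  incident {x} {y} {z} xy yz x≢z eq = p y x z (symm G xy) yz x≢z (trans (sym (s x y xy)) eq)

recolor : ∀ {n} → Fin n → (Fin n → ℕ) → (Fin n → Fin n → ℕ) → Fin n → Fin n → ℕ
recolor v g c x y with x ≟ v | y ≟ v
... | yes _ | _     = g y
... | no  _ | yes _ = g x
... | no  _ | no  _ = c x y

-- The last hypothesis covers both kinds of conflict with old edges: `u ≡ u′` gives properness at
-- `u`, and `u ≢ u′` separates the opposite edges `vu` and `wu′` of a 4-cycle `v u w u′`.
isBColoring-recolor : ∀ {n k c} (G : Graph n) (S : Subset n) (v : Fin n) (g : Fin n → ℕ) →
  IsBColoring (induced G (S - v)) k c →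
  let E = Adj (induced G S) in
  (∀ {u} → E v u → g u < k) →
  (∀ {u u′} → E v u → E v u′ → g u ≡ g u′ → u ≡ u′) →
  (∀ {u u′ w} → E v u → E v u′ → w ≢ v → E u w → E u′ w → g u ≢ c u′ w) →
  IsBColoring (induced G S) k (recolor v g c)
isBColoring-recolor {n} {k} {c} G S v g (isBColoring b s p r) g< g-inj g-avoid =
  isBColoring-opposite (induced G S) b′ s′ p′ o′
  where
  H = induced G S
  E = Adj H

  restrict : ∀ {x y} → E x y → x ≢ v → y ≢ v → Adj (induced G (S - v)) x y
  restrict (xy , x∈ , y∈) x≢v y≢v =
    xy , Subset.x∈p∧x≢y⇒x∈p-y x∈ x≢v , Subset.x∈p∧x≢y⇒x∈p-y y∈ y≢v

  c-sym : ∀ {x y} → E x y → x ≢ v → y ≢ v → c x y ≡ c y x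
  c-sym xy x≢v y≢v = s _ _ (restrict xy x≢v y≢v)

  b′ : ∀ x y → E x y → recolor v g c x y < k
  b′ x y xy with x ≟ v | y ≟ v
  ... | yes refl | _        = g< xy
  ... | no _     | yes refl = g< (symm H xy)
  ... | no x≢v   | no y≢v   = b x y (restrict xy x≢v y≢v)

  s′ : ∀ x y → E x y → recolor v g c x y ≡ recolor v g c y x
  s′ x y xy with x ≟ v | y ≟ v
  ... | yes refl | yes refl = refl
  ... | yes refl | no _     = refl
  ... | no _     | yes refl = refl
  ... | no x≢v   | no y≢v   = c-sym xy x≢v y≢v

  p′ : ∀ x y z → E x y → E x z → y ≢ z → recolor v g c x y ≢ recolor v g c x z
  p′ x y z xy xz y≢z with x ≟ v | y ≟ v | z ≟ v
  ... | yes refl | _        | _        = y≢z ∘ g-inj xy xz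
  ... | no _     | yes refl | yes refl = contradiction refl y≢z
  ... | no _     | yes refl | no z≢v   = g-avoid (symm H xy) (symm H xy) z≢v xz xz
  ... | no _     | no y≢v   | yes refl = ≢-sym (g-avoid (symm H xz) (symm H xz) y≢v xy xy)
  ... | no x≢v   | no y≢v   | no z≢v   = p x y z (restrict xy x≢v y≢v) (restrict xz x≢v z≢v) y≢z

  o′ : ∀ w x y z → FourCycle H w x y z → recolor v g c w x ≢ recolor v g c y z
  o′ w x y z (fourCycle u@((w≢x ∷ w≢y ∷ w≢z ∷ []) ∷ (x≢y ∷ x≢z ∷ []) ∷ (y≢z ∷ []) ∷ [] ∷ []) wx xy yz zw)
    -- The vertices of the cycle are distinct, so `v` is at most one of them. If it occurs, exactly
    -- one of the opposite edges `wx` and `yz` is new; otherwise both keep their old colors.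
    with w ≟ v | x ≟ v | y ≟ v | z ≟ v
  ... | yes refl | _        | yes refl | _        = contradiction refl w≢y
  ... | yes refl | _        | no _     | yes refl = contradiction refl w≢z
  ... | yes refl | _        | no y≢v   | no z≢v   =
        g-avoid wx (symm H zw) y≢v xy (symm H yz) ∘ λ eq → trans eq (c-sym yz y≢v z≢v)
  ... | no _     | yes refl | yes refl | _        = contradiction refl x≢y
  ... | no _     | yes refl | no _     | yes refl = contradiction refl x≢z
  ... | no _     | yes refl | no y≢v   | no z≢v   =
        g-avoid (symm H wx) xy z≢v (symm H zw) yz
  ... | no w≢v   | no x≢v   | yes refl | _        =
        g-avoid yz (symm H xy) w≢v zw (symm H wx) ∘ λ eq → trans (sym eq) (c-sym wx w≢v x≢v)
  ... | no w≢v   | no x≢v   | no _     | yes refl =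
        ≢-sym (g-avoid (symm H yz) zw x≢v (symm H xy) wx)
  ... | no w≢v   | no x≢v   | no y≢v   | no z≢v   = opposite
    where
    opposite : c w x ≢ c y z
    opposite with (_ ∷ d ∷ _) ∷ _ ← r w x y z (fourCycle u (restrict wx w≢v x≢v)
      (restrict xy x≢v y≢v) (restrict yz y≢v z≢v) (restrict zw z≢v w≢v)) = d

-- Codegrees and coloring in degeneracy order.

codegrees : ∀ {n} → Graph n → Fin n → List (Fin n) → List ℕ
codegrees G u = map λ w → ∣ N G u ∩ N G w ∣

-- The obstruction met by the greedy coloring with `m - 1` colors. The list holds the neighbors of
-- `center` present when it is added, so it may miss others in `G`. The leader belongs to the list
-- and contributes its full degree to the sum.
record Crowding {n} (G : Graph n) (d m : ℕ) : Set where
  field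
    center     : Fin n
    neighbors  : List (Fin n)
    unique     : Unique neighbors
    adjacent   : ∀ {u} → u List.∈ neighbors → Adj G center u
    few        : length neighbors ≤ d
    leader     : Fin n
    isNeighbor : leader List.∈ neighbors
    crowded    : m ≤ sum (codegrees G leader neighbors)

module _ {n} (G : Graph n) where

  ∈N⁺ : ∀ {x y} → Adj G x y → y ∈ N G x
  ∈N⁺ {x} = ∈-comprehension⁺ (adj? G x)

  ∈N⁻ : ∀ {x y} → y ∈ N G x → Adj G x y
  ∈N⁻ {x} = ∈-comprehension⁻ (adj? G x)

  -- The colors of a coloring of G - v that are ruled out for the edge vu, where us lists
  -- the neighbors of v: taking u′ = u gives the edges at u, the other u′ the edges
  -- opposite to vu in the 4-cycles v u w u′.
  forbidden : (Fin n → Fin n → ℕ) → Fin n → List (Fin n) → Fin n → List ℕ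
  forbidden c v us u = concatMap (λ u′ → map (c u′) (elements (N G u ∩ N G u′ - v))) us

  ∈-forbidden : ∀ {c v us u u′ w} → u′ List.∈ us → w ≢ v → Adj G u w → Adj G u′ w →
    c u′ w List.∈ forbidden c v us u
  ∈-forbidden {c} u′∈ w≢v uw u′w = ∈-concatMap⁺ _ (List.lose u′∈
    (∈-map⁺ (c _) (∈-elements⁺ (Subset.x∈p∧x≢y⇒x∈p-y (Subset.x∈p∩q⁺ (∈N⁺ uw , ∈N⁺ u′w)) w≢v))))

  -- The vertex `v` is a common neighbor of `u` and every member of `us`. Deleting it saves one
  -- color per member, which pays for the summand `length us`, the room that the edges at `v` need
  -- among themselves.
  length-forbidden : ∀ c {v u} us → Adj G v u → (∀ {w} → w List.∈ us → Adj G v w) →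
    length (forbidden c v us u) + length us ≤ sum (codegrees G u us)
  length-forbidden c         []       _  _   = z≤n
  length-forbidden c {v} {u} (w ∷ us) vu vus = begin
    length (xs ++ forbidden c v us u) + suc (length us)         ≡⟨ cong (_+ _) (List.length-++ xs) ⟩
    length xs + length (forbidden c v us u) + suc (length us)   ≡⟨ regroup (length xs) (length (forbidden c v us u)) (length us) ⟩
    suc (length xs) + (length (forbidden c v us u) + length us) ≤⟨ ℕ.+-mono-≤ step (length-forbidden c us vu (vus ∘ there)) ⟩
    ∣ N G u ∩ N G w ∣ + sum (codegrees G u us)                  ∎
    where
    open ℕ.≤-Reasoning
    xs = map (c w) (elements (N G u ∩ N G w - v))
    regroup : ∀ a b m → a + b + suc m ≡ suc a + (b + m)
    regroup = solve-∀
    step : suc (length xs) ≤ ∣ N G u ∩ N G w ∣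
    step = ℕ.≤-trans
      (s≤s (ℕ.≤-reflexive (trans (List.length-map (c w) (elements (N G u ∩ N G w - v))) (length-elements (N G u ∩ N G w - v)))))
      (Subset.x∈p⇒∣p-x∣<∣p∣ (Subset.x∈p∩q⁺ (∈N⁺ (symm G vu) , ∈N⁺ (symm G (vus (here refl))))))

  -- A vertex v of low degree is colored last.  Edges at v only conflict with each other and,
  -- through 4-cycles v u w u′, with old edges; the two old edges of such a cycle are incident,
  -- hence already of different colors.
  colorableOrCrowded : ∀ {d k} → Degenerate d G → ∀ S → Acc _⊂_ S →
    BColorable (induced G S) k ⊎ Crowding G d (suc k)
  colorableOrCrowded {d} {k} degenerate S (acc rec) with Subset.nonempty? S
  ... | no empty = inj₁ ((λ _ _ → 0) , isBColoring
          (λ x _ (_ , x∈ , _) → contradiction (x , x∈) empty)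
          (λ _ _ _ → refl)
          (λ x _ _ (_ , x∈ , _) → contradiction (x , x∈) empty)
          (λ w _ _ _ (fourCycle _ (_ , w∈ , _) _ _ _) → contradiction (w , w∈) empty))
  ... | yes ne with degenerate (inducedSubgraph G S) ne
  ... | v , v∈S , deg≤d with colorableOrCrowded degenerate (S - v) (rec (Subset.x∈p⇒p-x⊂p v∈S))
  ... | inj₂ crowding = inj₂ crowding
  -- If every sum is at most `k`, then `length-forbidden` provides the room for `greedyChoice`.
  -- Otherwise a neighbor whose sum exceeds `k` becomes the leader.
  ... | inj₁ (c , col) with All.all? (λ u → sum (codegrees G u us) ℕ.≤? k) us
    where us = elements (N (induced G S) v)
  ... | no crowded =
    let u , u∈ , ≰k = List.find (¬All⇒Any¬ (λ u → sum (codegrees G u us) ℕ.≤? k) us crowded)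
    in inj₂ record
      { center     = v
      ; neighbors  = us
      ; unique     = elements-unique (N (induced G S) v)
      ; adjacent   = λ u∈ → proj₁ (∈-comprehension⁻ (adj? (induced G S) v) (∈-elements⁻ _ u∈))
      ; few        = ℕ.≤-trans (ℕ.≤-reflexive (length-elements (N (induced G S) v))) deg≤d
      ; leader     = u
      ; isNeighbor = u∈
      ; crowded    = ℕ.≰⇒> ≰k
      }
    where us = elements (N (induced G S) v)
  ... | yes roomy = inj₁ (recolor v g c , isBColoring-recolor G S v g col
      (λ vu → proj₁ (proj₁ (proj₂ choice) (mem vu)))
      (λ vu vu′ → proj₂ (proj₂ choice) (mem vu) (mem vu′))
      (λ {u} vu vu′ w≢v uw u′w eq → proj₂ (proj₁ (proj₂ choice) (mem vu))
        (subst (List._∈ forbidden c v us u) (sym eq) (∈-forbidden (mem vu′) w≢v (proj₁ uw) (proj₁ u′w)))))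
    where
    us = elements (N (induced G S) v)
    mem : ∀ {u} → Adj (induced G S) v u → u List.∈ us
    mem vu = ∈-elements⁺ (∈-comprehension⁺ (adj? (induced G S) v) vu)
    adj : ∀ {u} → u List.∈ us → Adj G v u
    adj u∈ = proj₁ (∈-comprehension⁻ (adj? (induced G S) v) (∈-elements⁻ _ u∈))
    choice = greedyChoice _≟_ (forbidden c v us) k (elements-unique (N (induced G S) v))
      λ u∈ → ℕ.≤-trans (length-forbidden c us (adj u∈) adj) (All.lookup roomy u∈)
    g = proj₁ choice

  -- There is no `B`-coloring with `m - 1` colors by minimality of `qB G`, and the graph induced on
  -- all vertices has the edges of `G`. So the attempt with `m - 1` colors must end in a crowding.
  ≤qB⇒crowded : ∀ {d m} → Degenerate d G → 0 < m → m ≤ qB G → Crowding G d m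
  ≤qB⇒crowded {m = suc k} degenerate _ k<qB with colorableOrCrowded degenerate ⊤ (⊂-wellFounded ⊤)
  ... | inj₂ crowding  = crowding
  ... | inj₁ (c , col) = contradiction
    (proj₂ (proj₂ (bChromaticIndex G)) (c , isBColoring-mono (λ xy → xy , Subset.∈⊤ , Subset.∈⊤) col))
    (ℕ.<⇒≱ k<qB)

  -- The term of `u` itself is its degree; the term of each other `w` falls short of that degree by
  -- the size of `N G u ─ N G w`.
  codegrees-bound : ∀ {u m} us → m ≤ sum (codegrees G u (u ∷ us)) →
    m + sum (map (λ w → ∣ N G u ─ N G w ∣) us) ≤ suc (length us) * degree G u
  codegrees-bound {u} {m} us m≤ = begin
    m + D                        ≤⟨ ℕ.+-monoˡ-≤ D m≤ ⟩
    ∣ N G u ∩ N G u ∣ + I + D    ≡⟨ cong (λ p → ∣ p ∣ + I + D) (Subset.∩-idem (N G u)) ⟩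
    degree G u + I + D           ≡⟨ ℕ.+-assoc (degree G u) I D ⟩
    degree G u + (I + D)         ≡⟨ cong (degree G u +_) (trans (ℕ.+-comm I D) (sum-─+sum-∩ (N G u) (N G) us)) ⟩
    suc (length us) * degree G u ∎
    where
    open ℕ.≤-Reasoning
    I = sum (codegrees G u us)
    D = sum (map (λ w → ∣ N G u ─ N G w ∣) us)

  degree≤maxDegree : ∀ x → degree G x ≤ maxDegree G
  degree≤maxDegree = tabulate⁻ (xs≤max 0 (tabulate (degree G)))

  -- The images of `f` and `g` are disjoint because adjacent vertices are distinct, so the combined
  -- map is injective.
  containsK : ∀ {a b} {f : Fin a → Fin n} {g : Fin b → Fin n} →
    Injective _≡_ _≡_ f → Injective _≡_ _≡_ g → (∀ i j → Adj G (f i) (g j)) → ContainsCopy (K a b) G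
  containsK {a} {b} {f} {g} f-inj g-inj fg = [ f , g ]′ ∘ splitAt a , inj , adj
    where
    cases : ∀ s t → [ f , g ]′ s ≡ [ f , g ]′ t → s ≡ t
    cases (inj₁ i) (inj₁ j) eq = cong inj₁ (f-inj eq)
    cases (inj₁ i) (inj₂ j) eq = contradiction (fg i j) (irrefl G eq)
    cases (inj₂ i) (inj₁ j) eq = contradiction (fg j i) (irrefl G (sym eq))
    cases (inj₂ i) (inj₂ j) eq = cong inj₂ (g-inj eq)
    inj : Injective _≡_ _≡_ ([ f , g ]′ ∘ splitAt a)
    inj {x} {y} eq = trans (sym (Fin.join-splitAt a b x))
      (trans (cong (join a b) (cases (splitAt a x) (splitAt a y) eq)) (Fin.join-splitAt a b y))
    adj : ∀ {x y} → Adj (K a b) x y → Adj G ([ f , g ]′ (splitAt a x)) ([ f , g ]′ (splitAt a y))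
    adj {x} {y} x≁y with splitAt a x | splitAt a y
    ... | inj₁ i | inj₁ j = contradiction refl x≁y
    ... | inj₁ i | inj₂ j = fg i j
    ... | inj₂ i | inj₁ j = symm G (fg j i)
    ... | inj₂ i | inj₂ j = contradiction refl x≁y

-- Arithmetic of the extremal case, and rearranging lists and sums.

tight : ∀ {d Δ s m a D} → d ≤ Δ → s < d → m ≤ d → a ≤ Δ → d * Δ ∸ s + D ≤ m * a →
  m ≡ d × a ≡ Δ × D ≤ s
tight {d} {Δ} {s} {m} {a} {D} d≤Δ s<d m≤d a≤Δ le = go (begin
  -- Moving `s` to the other side removes the truncated subtraction.
  d * Δ + D                ≤⟨ ℕ.+-monoˡ-≤ D (ℕ.m≤n+m∸n (d * Δ) s) ⟩
  s + (d * Δ ∸ s) + D      ≡⟨ ℕ.+-assoc s _ D ⟩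
  s + (d * Δ ∸ s + D)      ≤⟨ ℕ.+-monoʳ-≤ s le ⟩
  s + m * a                ∎)
  where
  open ℕ.≤-Reasoning
  go : d * Δ + D ≤ s + m * a → m ≡ d × a ≡ Δ × D ≤ s
  go le with m ℕ.≟ d
  -- A missing neighbor costs a whole `Δ`, which exceeds the slack `s` because `s < d ≤ Δ`.
  ... | no m≢d = contradiction (begin-strict
          s + m * a  ≤⟨ ℕ.+-monoʳ-≤ s (ℕ.*-monoʳ-≤ m a≤Δ) ⟩
          s + m * Δ  <⟨ ℕ.+-monoˡ-< (m * Δ) (ℕ.<-≤-trans s<d d≤Δ) ⟩
          suc m * Δ  ≤⟨ ℕ.*-monoˡ-≤ Δ (ℕ.≤∧≢⇒< m≤d m≢d) ⟩
          d * Δ      ≤⟨ ℕ.m≤m+n _ D ⟩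
          d * Δ + D  ∎) (ℕ.≤⇒≯ le)
  ... | yes refl with a ℕ.≟ Δ
  -- A degree below `Δ` costs at least one in each of the `m` terms, and now `m` is `d`, which
  -- exceeds `s`.
  ...   | no a≢Δ = contradiction (begin-strict
          s + m * a  <⟨ ℕ.+-monoˡ-< (m * a) s<d ⟩
          m + m * a  ≡⟨ ℕ.*-suc m a ⟨
          m * suc a  ≤⟨ ℕ.*-monoʳ-≤ m (ℕ.≤∧≢⇒< a≤Δ a≢Δ) ⟩
          m * Δ      ≤⟨ ℕ.m≤m+n _ D ⟩
          m * Δ + D  ∎) (ℕ.≤⇒≯ le)
  ...   | yes refl = refl , refl , ℕ.+-cancelˡ-≤ (m * a) D s
          (ℕ.≤-trans le (ℕ.≤-reflexive (ℕ.+-comm s (m * a))))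

∈⇒↭∷ : ∀ {a} {A : Set a} {x : A} {xs} → x List.∈ xs → ∃ λ ys → xs ↭ x ∷ ys
∈⇒↭∷ {x = x} x∈ with ys , zs , refl ← ∈-∃++ x∈ = ys ++ zs , shift x ys zs

sum-tabulate-lookup : ∀ {a} {A : Set a} (f : A → ℕ) xs →
  sum (tabulate (f ∘ lookup xs)) ≡ sum (map f xs)
sum-tabulate-lookup f xs = cong sum
  (trans (sym (List.map-tabulate (lookup xs) f)) (cong (map f) (List.tabulate-lookup xs)))

sum-map-≤-* : ∀ {a} {A : Set a} (f g : A → ℕ) c → (∀ x → f x ≤ c * g x) →
  ∀ xs → sum (map f xs) ≤ c * sum (map g xs)
sum-map-≤-* f g c f≤cg []       = z≤n
sum-map-≤-* f g c f≤cg (x ∷ xs) = ℕ.≤-trans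
  (ℕ.+-mono-≤ (f≤cg x) (sum-map-≤-* f g c f≤cg xs))
  (ℕ.≤-reflexive (sym (ℕ.*-distribˡ-+ c (g x) _)))

-- Nearly equal neighborhoods and the complete bipartite subgraphs they give.

module NearTwins {n} (G : Graph n) (u₁ : Fin n) (us : List (Fin n)) (unique : Unique (u₁ ∷ us))
  (dominant : ∀ w → degree G w ≤ degree G u₁)
  (s : ℕ) (near : sum (map (λ w → ∣ N G u₁ ─ N G w ∣) us) ≤ s) where

  d : ℕ
  d = suc (length us)

  u : Fin d → Fin n
  u = lookup (u₁ ∷ us)

  u-injective : Injective _≡_ _≡_ u
  u-injective = lookup-injective unique

  sum-─≤s : sum (drop 1 (tabulate λ j → ∣ N G u₁ ─ N G (u j) ∣)) ≤ s
  sum-─≤s = ℕ.≤-trans (ℕ.≤-reflexive (sum-tabulate-lookup _ us)) near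

  sum-⊕≤2s : sum (drop 1 (tabulate λ j → ∣ N G u₁ ⊕ N G (u j) ∣)) ≤ 2 * s
  sum-⊕≤2s = begin
    sum (drop 1 (tabulate λ j → ∣ N G u₁ ⊕ N G (u j) ∣))  ≡⟨ sum-tabulate-lookup _ us ⟩
    sum (map (λ w → ∣ N G u₁ ⊕ N G w ∣) us)               ≤⟨ sum-map-≤-* _ _ 2 (λ w → ∣p⊕q∣≤2∣p─q∣ (N G u₁) (N G w) (dominant w)) us ⟩
    2 * sum (map (λ w → ∣ N G u₁ ─ N G w ∣) us)           ≤⟨ ℕ.*-monoʳ-≤ 2 near ⟩
    2 * s                                                 ∎
    where open ℕ.≤-Reasoning

  twins : Subset d
  twins = zeros (λ j → ∣ N G u₁ ─ N G (u j) ∣)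

  twins⇒≡ : ∀ {i} → i ∈ twins → N G u₁ ≡ N G (u i)
  twins⇒≡ {i} i∈ = ∣p─q∣≡0⇒p≡q (N G u₁) (N G (u i)) (dominant (u i))
    (∈-comprehension⁻ (λ j → ∣ N G u₁ ─ N G (u j) ∣ ℕ.≟ 0) i∈)

  -- The differences are natural numbers with sum at most `s`, so at most `s` of them are nonzero.
  d∸s≤∣twins∣ : d ∸ s ≤ ∣ twins ∣
  d∸s≤∣twins∣ = ℕ.m≤n+o⇒m∸n≤o d s (begin
    d                                                         ≤⟨ d≤∣zeros∣+sum (λ j → ∣ N G u₁ ─ N G (u j) ∣) ⟩
    -- The first term compares `u₁` with itself and vanishes, so the bound on the remaining terms
    -- suffices.
    ∣ twins ∣ + sum (tabulate λ j → ∣ N G u₁ ─ N G (u j) ∣)   ≡⟨ cong (λ m → ∣ twins ∣ + (m + rest)) (∣p─p∣≡0 (N G u₁)) ⟩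
    ∣ twins ∣ + rest                                          ≤⟨ ℕ.+-monoʳ-≤ ∣ twins ∣ sum-─≤s ⟩
    ∣ twins ∣ + s                                             ≡⟨ ℕ.+-comm ∣ twins ∣ s ⟩
    s + ∣ twins ∣                                             ∎)
    where
    open ℕ.≤-Reasoning
    rest = sum (drop 1 (tabulate λ j → ∣ N G u₁ ─ N G (u j) ∣))

  -- The twins form one side and their shared neighborhood `N G u₁` the other.
  containsK[d∸s,Δ] : ContainsCopy (K (d ∸ s) (degree G u₁)) G
  containsK[d∸s,Δ] =
    let f , f-inj , f∈ = choose twins d∸s≤∣twins∣
        g , g-inj , g∈ = choose (N G u₁) ℕ.≤-refl
    in containsK G (f-inj ∘ u-injective) g-inj λ i j →
         ∈N⁻ G (subst (g j ∈_) (twins⇒≡ (f∈ i)) (g∈ j))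

  -- All the `u j` form one side and their common neighborhood the other; it misses at most `s`
  -- elements of `N G u₁`.
  containsK[d,Δ∸s] : ContainsCopy (K d (degree G u₁ ∸ s)) G
  containsK[d,Δ∸s] =
    let g , g-inj , g∈ = choose (intersect (N G u₁) (N G) us) (ℕ.m≤n+o⇒m∸n≤o _ s (begin
          degree G u₁          ≤⟨ ∣p∣≤∣intersect∣+sum-─ (N G u₁) (N G) us ⟩
          common + _           ≤⟨ ℕ.+-monoʳ-≤ common near ⟩
          common + s           ≡⟨ ℕ.+-comm common s ⟩
          s + common           ∎))
    in containsK G u-injective g-inj λ
         { zero    j → ∈N⁻ G (intersect⊆p (N G u₁) (N G) us (g∈ j))
         ; (suc i) j → ∈N⁻ G (intersect⊆q (N G u₁) (N G) (∈-lookup {xs = us} i) (g∈ j)) }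
    where
    open ℕ.≤-Reasoning
    common = ∣ intersect (N G u₁) (N G) us ∣

corollary2p4 : (d Δ s : ℕ) (1≤d : 1 ≤ d) → d ≤ Δ → s < d →
    ∀ {n} (G : Graph n) → Degenerate d G → maxDegree G ≤ Δ → d * Δ ∸ s ≤ qB G →
    (∃ λ (v : Fin n) → ∃ λ (u : Fin d → Fin n) →
    let u₁ = u (fromℕ< 1≤d) in
    Injective _≡_ _≡_ u
    × (∀ j → Adj G v (u j))
    × degree G u₁ ≡ Δ
    × sum (drop 1 (tabulate λ j → ∣ N G u₁ ─ N G (u j) ∣)) ≤ s
    × sum (drop 1 (tabulate λ j → ∣ N G u₁ ⊕ N G (u j) ∣)) ≤ 2 * s
    × (∃ λ (J : Subset d) →
    d ∸ s ≤ ∣ J ∣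
    × (∀ {i} → i ∈ J → degree G (u i) ≡ Δ)
    × (∀ {i j} → i ∈ J → j ∈ J → N G (u i) ≡ N G (u j))))
    × ContainsCopy (K (d ∸ s) Δ) G
    × ContainsCopy (K d (Δ ∸ s)) G
corollary2p4 d Δ s 1≤d d≤Δ s<d G degenerate maxDegree≤Δ dΔ∸s≤qB
  -- The bound on `qB G` is positive: `s < d ≤ d * Δ`, as `Δ` is at least 1.
  with record { center = v ; neighbors = ws ; unique = ws! ; adjacent = vws ; few = few
              ; leader = u₁ ; isNeighbor = u₁∈ws ; crowded = crowded }
         ← ≤qB⇒crowded G degenerate (ℕ.m<n⇒0<n∸m (ℕ.<-≤-trans s<d
             (ℕ.≤-trans (ℕ.≤-reflexive (sym (ℕ.*-identityʳ d))) (ℕ.*-monoʳ-≤ d (ℕ.≤-trans 1≤d d≤Δ)))))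
             dΔ∸s≤qB
  -- The leader is moved to the front to serve as `u₁`; the codegree sum and the length are
  -- invariant under permutation.
  with us , σ ← ∈⇒↭∷ u₁∈ws
  with degree≤Δ ← (λ w → ℕ.≤-trans (degree≤maxDegree G w) maxDegree≤Δ)
  -- The two equations replace `d` by `suc (length us)` and `Δ` by `degree G u₁`, the forms in which
  -- `NearTwins` states its results.
  with refl , refl , D≤s ← tight d≤Δ s<d (subst (_≤ d) (↭-length σ) few) (degree≤Δ u₁)
         (codegrees-bound G us (subst (d * Δ ∸ s ≤_) (sum-↭ (↭-map⁺ _ σ)) crowded)) =
    ( v , u , u-injective
    , (λ j → vws (∈-resp-↭ (↭-sym σ) (∈-lookup j)))
    , refl , sum-─≤s , sum-⊕≤2s , twins , d∸s≤∣twins∣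
    , (λ i∈ → sym (cong ∣_∣ (twins⇒≡ i∈)))
    , (λ i∈ j∈ → trans (sym (twins⇒≡ i∈)) (twins⇒≡ j∈)) )
  , containsK[d∸s,Δ] , containsK[d,Δ∸s]
  where open NearTwins G u₁ us (Permutationₛ.Unique-resp-↭ (setoid _) (↭⇒↭ₛ σ) ws!) degree≤Δ s D≤s
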